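{- Let $p=\sum_{i=0}^n c_iT^i$ be a polynomial of degree $n\ge1$ over $\mathbb T$, and let $a_1\le\dots\le a_n$ be the unique elements of $\mathbb T$ with $c_n^{ -1}p\in\boxdot_{i=1}^n(T+a_i)$. Let $a\ne0$ be one of the $a_i$, and let $k\in\{1,\dots,n\}$ and $m\ge1$ be such that $a=a_k=\dots=a_{k+m-1}$, $a_{k-1}<a_k$ if $k\ge2$, and $a_{k+m-1}<a_{k+m}$ if $k+m\le n$. Define $d_0,\dots,d_{n-1}\in\mathbb T$ by: (1) if $k\le n-m$: $d_{n-1}=c_n$ and, for $i=n-2,n-3,\dots,k+m-1$ (in decreasing order), $d_i=\max\{c_{i+1},ad_{i+1}\}$; (2) if $k\ge2$: $d_0=a^{ -1}c_0$ and, for $i=1,\dots,k-2$ (in increasing order), $d_i=\max\{a^{ -1}c_i,a^{ -1}d_{i-1}\}$; (3) for $i=k-1,\dots,k+m-2$: $d_i=a_{i+2}a_{i+3}\cdots a_nc_n$ (an empty product being $1$). Then $q=\sum_{i=0}^{n-1}d_iT^i$ satisfies $p\in(T+a)\boxdot q$, i.e. $c_n=d_{n-1}$, $c_0=ad_0$, and $c_i\in (ad_i)\boxplus d_{i-1}$ for $i=1,\dots,n-1$.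
   Context: The tropical hyperfield $\mathbb T$ is $\mathbb R_{\ge0}$ with usual multiplication and hyperaddition $a\boxplus b=\{\max\{a,b\}\}$ if $a\ne b$, $a\boxplus a=[0,a]$ (so $c\in a\boxplus b$ iff the maximum of $a,b,c$ is attained at least twice; $-a=a$). Iterated sums: $\boxplus_{i=1}^n a_i=\bigcup_{b\in\boxplus_{i=1}^{n-1}a_i} b\boxplus a_n$. A polynomial over $\mathbb T$ is a finitely supported sequence $(c_i)$, written $\sum c_iT^i$. Hyperproduct: $p\boxdot q=\{\sum e_iT^i : e_i\in \boxplus_{k+l=i} c_kd_l\}$, and $\boxdot_{i=1}^n q_i=\bigcup_{r\in\boxdot_{i=1}^{n-1}q_i} r\boxdot q_n$. Known fact (fundamental theorem for $\mathbb T$): for monic $p$ of degree $n$ there is a unique sequence $a_1\le\dots\le a_n$ in $\mathbb T$ with $p\in\boxdot_{i=1}^n(T+a_i)$; this holds iff $c_i\le a_{i+1}\cdots a_n$ for all $i=0,\dots,n-1$ with equality whenever $a_i<a_{i+1}$ (for $i\ge1$) or $i=0$ and $a_0$ is not defined—precisely: $c_0=a_1\cdots a_n$ and $c_i=a_{i+1}\cdots a_n$ when $a_i<a_{i+1}$; the roots of $p$ are exactly $a_1,\dots,a_n$. -}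

module Defs where

open import Data.Nat.Base as ℕ using (ℕ; zero; suc; _∸_; z≤n; s≤s)
import Data.Nat.Properties as ℕₚ
open import Data.Rational.Base as ℚ using (ℚ; 0ℚ; 1ℚ; positive; nonNegative; 1/_)
import Data.Rational.Properties as ℚₚ
open import Data.Product.Base using (∃; _×_; _,_; proj₁; proj₂)
open import Data.Sum.Base using (_⊎_; inj₁; inj₂)
open import Data.Empty using (⊥; ⊥-elim)
open import Level using (0ℓ)
open import Relation.Binary.PropositionalEquality using (_≡_; refl; sym; subst)
open import Relation.Nullary using (¬_; yes; no)
open import Relation.Unary using (Pred; _∈_)

-- A nonnegative real x is given by the Dedekind lower cut {q ∈ ℚ | 0 < q < x};
-- the empty cut is 0.  Strict order is witnessed by a rational, while ≤ and ≈
-- are its negations, so that ≤ and ≈ are ¬¬-stable.  Classically this is ℝ≥0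
-- with its usual order.  Boundedness is stated negatively so that the inverse
-- exists for every x with ¬ (x ≈ 0).

record ℝ≥0 : Set₁ where
  field
    L        : Pred ℚ 0ℓ
    pos      : ∀ {q} → L q → 0ℚ ℚ.< q
    lower    : ∀ {p q} → 0ℚ ℚ.< p → p ℚ.≤ q → L q → L p
    open′    : ∀ {q} → L q → ∃ λ r → q ℚ.< r × L r
    bounded  : ¬ ¬ (∃ λ q → 0ℚ ℚ.< q × ¬ L q)

open ℝ≥0 public using (L)

infix 4 _<_ _≤_ _≈_ _≉_

_<_ _≤_ _≈_ _≉_ : ℝ≥0 → ℝ≥0 → Set
x < y = ∃ λ q → L y q × ¬ L x q
x ≤ y = ¬ (y < x)
x ≈ y = x ≤ y × y ≤ x
x ≉ y = ¬ (x ≈ y)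

0<1 : 0ℚ ℚ.< 1ℚ
0<1 = ℚₚ.positive⁻¹ 1ℚ

*-mono-≤ : ∀ {p q r s} → 0ℚ ℚ.< q → 0ℚ ℚ.< r →
           p ℚ.≤ q → r ℚ.≤ s → p ℚ.* r ℚ.≤ q ℚ.* s
*-mono-≤ {p} {q} {r} {s} 0<q 0<r p≤q r≤s = ℚₚ.≤-trans
  (ℚₚ.*-monoʳ-≤-nonNeg r {{nonNegative (ℚₚ.<⇒≤ 0<r)}} p≤q)
  (ℚₚ.*-monoˡ-≤-nonNeg q {{nonNegative (ℚₚ.<⇒≤ 0<q)}} r≤s)

*-mono-< : ∀ {p q r s} → 0ℚ ℚ.< q → 0ℚ ℚ.< r →
           p ℚ.< q → r ℚ.< s → p ℚ.* r ℚ.< q ℚ.* s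
*-mono-< {p} {q} {r} {s} 0<q 0<r p<q r<s = ℚₚ.<-trans
  (ℚₚ.*-monoˡ-<-pos r {{positive 0<r}} p<q)
  (ℚₚ.*-monoʳ-<-pos q {{positive 0<q}} r<s)

0<* : ∀ {p q} → 0ℚ ℚ.< p → 0ℚ ℚ.< q → 0ℚ ℚ.< p ℚ.* q
0<* {p} {q} 0<p 0<q =
  subst (ℚ._< p ℚ.* q) (ℚₚ.*-zeroˡ q) (ℚₚ.*-monoˡ-<-pos q {{positive 0<q}} 0<p)

below : ∀ x {p q} → L x p → 0ℚ ℚ.< q → ¬ L x q → p ℚ.< q
below x Lp 0<q ¬Lq = ℚₚ.≰⇒> λ q≤p → ¬Lq (ℝ≥0.lower x 0<q q≤p Lp)

room : ∀ {q s} → 0ℚ ℚ.< s → q ℚ.* s ℚ.< 1ℚ → ∃ λ r → q ℚ.< r × r ℚ.* s ℚ.< 1ℚ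
room {q} {s} 0<s qs<1 =
  r , q<r , subst (r ℚ.* s ℚ.<_) (ℚₚ.*-inverseˡ s) (ℚₚ.*-monoˡ-<-pos s r<1/s)
  where
  instance
    s⁺ : ℚ.Positive s
    s⁺ = positive 0<s
    s≢0 : ℚ.NonZero s
    s≢0 = ℚₚ.pos⇒nonZero s
  q<1/s : q ℚ.< 1/ s
  q<1/s = ℚₚ.*-cancelʳ-<-nonNeg s {{nonNegative (ℚₚ.<⇒≤ 0<s)}}
            (subst (q ℚ.* s ℚ.<_) (sym (ℚₚ.*-inverseˡ s)) qs<1)
  dense = ℚₚ.<-dense q<1/s
  r = proj₁ dense
  q<r = proj₁ (proj₂ dense)
  r<1/s = proj₂ (proj₂ dense)

0ᵣ : ℝ≥0
0ᵣ = record
  { L = λ _ → ⊥ ; pos = λ () ; lower = λ _ _ () ; open′ = λ ()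
  ; bounded = λ k → k (1ℚ , 0<1 , λ ()) }

1ᵣ : ℝ≥0
1ᵣ = record
  { L        = λ q → 0ℚ ℚ.< q × q ℚ.< 1ℚ
  ; pos      = proj₁
  ; lower    = λ 0<p p≤q (_ , q<1) → 0<p , ℚₚ.≤-<-trans p≤q q<1
  ; open′    = λ (0<q , q<1) → let (r , q<r , r<1) = ℚₚ.<-dense q<1
                               in r , q<r , ℚₚ.<-trans 0<q q<r , r<1
  ; bounded  = λ k → k (1ℚ , 0<1 , λ (_ , 1<1) → ℚₚ.<-irrefl refl 1<1)
  }

infixl 6 _⊔_
infixl 7 _*_

_⊔_ : ℝ≥0 → ℝ≥0 → ℝ≥0
x ⊔ y = record
  { L        = λ q → L x q ⊎ L y q
  ; pos      = λ { (inj₁ l) → X.pos l ; (inj₂ l) → Y.pos l }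
  ; lower    = λ { 0<p p≤q (inj₁ l) → inj₁ (X.lower 0<p p≤q l)
                 ; 0<p p≤q (inj₂ l) → inj₂ (Y.lower 0<p p≤q l) }
  ; open′    = λ { (inj₁ l) → let (r , q<r , l′) = X.open′ l in r , q<r , inj₁ l′
                 ; (inj₂ l) → let (r , q<r , l′) = Y.open′ l in r , q<r , inj₂ l′ }
  ; bounded  = λ k → X.bounded λ (p , 0<p , ¬p) → Y.bounded λ (q , 0<q , ¬q) →
      k (p ℚ.⊔ q , ℚₚ.<-≤-trans 0<p (ℚₚ.p≤p⊔q p q) ,
         λ { (inj₁ l) → ¬p (X.lower 0<p (ℚₚ.p≤p⊔q p q) l)
           ; (inj₂ l) → ¬q (Y.lower 0<q (ℚₚ.p≤q⊔p p q) l) })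
  }
  where module X = ℝ≥0 x
        module Y = ℝ≥0 y

_*_ : ℝ≥0 → ℝ≥0 → ℝ≥0
x * y = record
  { L        = λ q → 0ℚ ℚ.< q × ∃ λ a → ∃ λ b → L x a × L y b × q ℚ.≤ a ℚ.* b
  ; pos      = proj₁
  ; lower    = λ 0<p p≤q (_ , a , b , la , lb , q≤ab) →
      0<p , a , b , la , lb , ℚₚ.≤-trans p≤q q≤ab
  ; open′    = λ (0<q , a , b , la , lb , q≤ab) →
      let (a′ , a<a′ , la′) = X.open′ la
          (b′ , b<b′ , lb′) = Y.open′ lb
      in a′ ℚ.* b′
         , ℚₚ.≤-<-trans q≤ab (*-mono-< (X.pos la′) (Y.pos lb) a<a′ b<b′)
         , 0<* (X.pos la′) (Y.pos lb′) , a′ , b′ , la′ , lb′ , ℚₚ.≤-refl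
  ; bounded  = λ k → X.bounded λ (p , 0<p , ¬p) → Y.bounded λ (q , 0<q , ¬q) →
      k (p ℚ.* q , 0<* 0<p 0<q , λ (_ , a , b , la , lb , pq≤ab) →
        ℚₚ.<-irrefl refl (ℚₚ.≤-<-trans pq≤ab
          (*-mono-< 0<p (Y.pos lb) (below x la 0<p ¬p) (below y lb 0<q ¬q))))
  }
  where module X = ℝ≥0 x
        module Y = ℝ≥0 y

-- The cut of x⁻¹: q < x⁻¹ iff q < s⁻¹ for some rational s ≥ x.
inv : (x : ℝ≥0) → x ≉ 0ᵣ → ℝ≥0
inv x x≉0 = record
  { L        = λ q → 0ℚ ℚ.< q × ∃ λ s → 0ℚ ℚ.< s × ¬ L x s × q ℚ.* s ℚ.< 1ℚ
  ; pos      = proj₁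
  ; lower    = λ {p} {q} 0<p p≤q (0<q , s , 0<s , ¬s , qs<1) →
      0<p , s , 0<s , ¬s ,
      ℚₚ.≤-<-trans (*-mono-≤ 0<q 0<s p≤q ℚₚ.≤-refl) qs<1
  ; open′    = λ (0<q , s , 0<s , ¬s , qs<1) →
      let (r , q<r , rs<1) = room 0<s qs<1
      in r , q<r , ℚₚ.<-trans 0<q q<r , s , 0<s , ¬s , rs<1
  ; bounded  = λ k → x≉0 ((λ (r , lr , _) → k (unbounded r lr)) , λ ())
  }
  where
  module X = ℝ≥0 x
  unbounded : ∀ r → L x r → ∃ λ q → 0ℚ ℚ.< q ×
    ¬ (0ℚ ℚ.< q × ∃ λ s → 0ℚ ℚ.< s × ¬ L x s × q ℚ.* s ℚ.< 1ℚ)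
  unbounded r lr = 1/ r , 0<1/r , λ (_ , s , 0<s , ¬s , s/r<1) →
    ℚₚ.<-irrefl refl (ℚₚ.<-trans s/r<1
      (subst (ℚ._< 1/ r ℚ.* s) (ℚₚ.*-inverseˡ r)
        (ℚₚ.*-monoʳ-<-pos (1/ r) (below x lr 0<s ¬s))))
    where
    instance
      r⁺ : ℚ.Positive r
      r⁺ = positive (X.pos lr)
      r≢0 : ℚ.NonZero r
      r≢0 = ℚₚ.pos⇒nonZero r
      1/r⁺ : ℚ.Positive (1/ r)
      1/r⁺ = ℚₚ.1/pos⇒pos r
    0<1/r : 0ℚ ℚ.< 1/ r
    0<1/r = ℚₚ.positive⁻¹ (1/ r)

product : (ℕ → ℝ≥0) → (l t : ℕ) → ℝ≥0
product a l zero    = 1ᵣ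
product a l (suc t) = a l * product a (suc l) t

-- ∏[ l ⋯ n ] a is a l ⋯ a n, equal to 1 when n < l.
∏[_⋯_] : (l n : ℕ) → (ℕ → ℝ≥0) → ℝ≥0
∏[ l ⋯ n ] a = product a l (suc n ∸ l)

𝕋 : Set₁
𝕋 = ℝ≥0

infixl 6 _⊞_

-- c ∈ a ⊞ b: {max a b} if a ≠ b and [0, a] if a = b, as a pair of implications
-- because equality on 𝕋 is not decidable.
_⊞_ : 𝕋 → 𝕋 → Pred 𝕋 0ℓ
(a ⊞ b) c = (a ≉ b → c ≈ a ⊔ b) × (a ≈ b → c ≤ a)

-- ⊞Σ f n is the iterated hypersum of the n + 1 terms f 0, …, f n.
data ⊞Σ (f : ℕ → 𝕋) : ℕ → Pred 𝕋 (Level.suc 0ℓ) where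
  single : ∀ {c} → c ≈ f 0 → c ∈ ⊞Σ f 0
  step   : ∀ {n b c} → b ∈ ⊞Σ f n → c ∈ b ⊞ f (suc n) → c ∈ ⊞Σ f (suc n)

record Poly : Set₁ where
  field
    coeff         : ℕ → 𝕋
    finiteSupport : ∃ λ N → ∀ i → N ℕ.≤ i → coeff i ≈ 0ᵣ

open Poly public

infix 4 _≈ₚ_

_≈ₚ_ : Poly → Poly → Set
p ≈ₚ q = ∀ i → coeff p i ≈ coeff q i

record HasDegree (p : Poly) (n : ℕ) : Set where
  field
    leading≉0 : coeff p n ≉ 0ᵣ
    above≈0   : ∀ i → n ℕ.< i → coeff p i ≈ 0ᵣ

open HasDegree public

≈-refl : ∀ x → x ≈ x
≈-refl x = (λ (_ , l , ¬l) → ¬l l) , (λ (_ , l , ¬l) → ¬l l)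

*-zeroʳ : ∀ x y → y ≈ 0ᵣ → x * y ≈ 0ᵣ
*-zeroʳ x y y≈0 =
  (λ (_ , (_ , _ , b , _ , lb , _) , _) → proj₁ y≈0 (b , lb , λ ())) , λ ()

T+_ : 𝕋 → Poly
coeff (T+ a) 0             = a
coeff (T+ a) 1             = 1ᵣ
coeff (T+ a) (suc (suc _)) = 0ᵣ
finiteSupport (T+ a) = 2 , λ { (suc (suc _)) (s≤s (s≤s z≤n)) → ≈-refl 0ᵣ }

infixr 7 _·ₚ_

_·ₚ_ : 𝕋 → Poly → Poly
coeff (c ·ₚ p) i = c * coeff p i
finiteSupport (c ·ₚ p) = let (N , h) = finiteSupport p
                         in N , λ i N≤i → *-zeroʳ c (coeff p i) (h i N≤i)

-- d 0 + d 1 T + ⋯ + d (n - 1) Tⁿ⁻¹; the values d i with i ≥ n are not used.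
polyBelow : ℕ → (ℕ → 𝕋) → Poly
coeff (polyBelow n d) i with i ℕₚ.<? n
... | yes _ = d i
... | no  _ = 0ᵣ
finiteSupport (polyBelow n d) = n , vanish
  where
  vanish : ∀ i → n ℕ.≤ i → coeff (polyBelow n d) i ≈ 0ᵣ
  vanish i n≤i with i ℕₚ.<? n
  ... | yes i<n = ⊥-elim (ℕₚ.<⇒≱ i<n n≤i)
  ... | no  _   = ≈-refl 0ᵣ

infixl 7 _⊡_

_⊡_ : Poly → Poly → Pred Poly (Level.suc 0ℓ)
(p ⊡ q) e = ∀ i → coeff e i ∈ ⊞Σ (λ k → coeff p k * coeff q (i ∸ k)) i

-- ⊡∏ q n is the iterated hyperproduct of q 1, …, q n, for n ≥ 1.
data ⊡∏ (q : ℕ → Poly) : ℕ → Pred Poly (Level.suc 0ℓ) where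
  single : ∀ {r} → r ≈ₚ q 1 → r ∈ ⊡∏ q 1
  step   : ∀ {n r s} → r ∈ ⊡∏ q n → s ∈ r ⊡ q (suc n) → s ∈ ⊡∏ q (suc n)

{-# OPTIONS --safe #-}

-- Let c be the coefficients of p and C their Newton polygon: C n = c n and
-- C i = a (i + 1) C (i + 1).  Multiplying the linear factors in order of increasing
-- roots, one finds c ≤ C, with equality at the ends of every edge.  On the edge of
-- slope α, d i = C (i + 1), so α d i = C i = d (i - 1) and any c i ≤ C i lies in
-- α d i ⊞ d (i - 1).  Off this edge each recursion says that one of d (i - 1), α d i is
-- the maximum of the other and c i, which is enough.  At the two ends of the edge
-- c = C, and the recursions give d i ≤ C (i + 1), which makes the term coming from
-- outside the edge the smaller one.
--
-- Equality on ℝ≥0 is undecidable, but ≤ is ¬¬-stable, so case distinctions on the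
-- order are available whenever the goal is an inequality.

module Submission where

open import Data.Nat.Base as ℕ using (ℕ; zero; suc; _+_; _∸_; z≤n; s≤s)
import Data.Integer.Base as ℤ
import Data.Integer.Properties as ℤₚ
open import Data.Nat.Coprimality as Coprimality using (1-coprimeTo)
open import Data.Rational.Base as ℚ using (ℚ; 0ℚ; 1ℚ; mkℚ; positive; nonNegative; 1/_; *≤*)
import Data.Rational.Properties as ℚₚ
import Data.Rational.Unnormalised.Base as ℚᵘ
import Data.Rational.Unnormalised.Properties as ℚᵘₚ
import Data.Nat.Properties as ℕₚ
open import Data.Product.Base using (∃; _×_; _,_; proj₁; proj₂; swap)
open import Data.Sum.Base using (inj₁; inj₂)
import Level
open import Function.Base using (_∘_; const)
open import Relation.Binary.Bundles using (Poset)
open import Relation.Binary.Definitions using (tri<; tri≈; tri>)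
open import Relation.Binary.PropositionalEquality using (_≡_; refl; sym; trans; cong; subst; subst₂)
open import Relation.Nullary using (¬_; Dec; yes; no; contradiction)
open import Relation.Nullary.Decidable.Core using (¬¬-excluded-middle)
open import Relation.Nullary.Negation.Core using (¬¬-map; negated-stable)
open import Relation.Unary using (_∈_; Pred)

-- Axioms of a tropical semifield.

record TropicalSemifield c ℓ : Set (Level.suc (c Level.⊔ ℓ)) where
  infix  4 _≤_ _≈_
  infixl 6 _⊔_
  infixl 7 _*_
  field
    Carrier : Set c
    _≤_     : Carrier → Carrier → Set ℓ
    _⊔_ _*_ : Carrier → Carrier → Carrier
    0# 1#   : Carrier

  _≈_ : Carrier → Carrier → Set ℓ
  x ≈ y = x ≤ y × y ≤ x

  field
    ≤-refl      : ∀ {x} → x ≤ x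
    ≤-trans     : ∀ {x y z} → x ≤ y → y ≤ z → x ≤ z
    -- Together with `≰⇒≥` this stands in for a decidable total order.
    ≤-stable    : ∀ {x y} → ¬ ¬ (x ≤ y) → x ≤ y
    ≰⇒≥         : ∀ {x y} → ¬ (x ≤ y) → y ≤ x
    x≤x⊔y       : ∀ x y → x ≤ x ⊔ y
    y≤x⊔y       : ∀ x y → y ≤ x ⊔ y
    ⊔-lub       : ∀ {x y z} → x ≤ z → y ≤ z → x ⊔ y ≤ z
    0≤          : ∀ x → 0# ≤ x
    1≰0         : ¬ (1# ≤ 0#)
    *-mono-≤    : ∀ {x y u v} → x ≤ y → u ≤ v → x * u ≤ y * v
    *-comm      : ∀ x y → x * y ≈ y * x
    *-assoc     : ∀ x y z → (x * y) * z ≈ x * (y * z)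
    *-identityˡ : ∀ x → 1# * x ≈ x
    *-zeroˡ     : ∀ x → 0# * x ≈ 0#
    inverse     : ∀ {x} → ¬ (x ≤ 0#) → ∃ λ y → y * x ≈ 1#

module Tropical {c ℓ} (S : TropicalSemifield c ℓ) where
  open TropicalSemifield S public

  poset : Poset c ℓ ℓ
  poset = record
    { Carrier = Carrier ; _≈_ = _≈_ ; _≤_ = _≤_
    ; isPartialOrder = record
      { isPreorder = record
        { isEquivalence = record
          { refl  = ≤-refl , ≤-refl
          ; sym   = swap
          ; trans = λ (p , p′) (q , q′) → ≤-trans p q , ≤-trans q′ p′ }
        ; reflexive = proj₁
        ; trans     = ≤-trans }
      ; antisym = _,_ } }

  open Poset poset public using (module Eq; ≤-respʳ-≈)
  open Eq public using () renaming (refl to ≈-refl; sym to ≈-sym; trans to ≈-trans)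
  open import Relation.Binary.Reasoning.PartialOrder poset

  by-cases : ∀ {a x y} (A : Set a) → (Dec A → x ≤ y) → x ≤ y
  by-cases A f = ≤-stable (¬¬-map f ¬¬-excluded-middle)

  *-cong : ∀ {x y u v} → x ≈ y → u ≈ v → x * u ≈ y * v
  *-cong (p , p′) (q , q′) = *-mono-≤ p q , *-mono-≤ p′ q′

  *-congˡ : ∀ {x u v} → u ≈ v → x * u ≈ x * v
  *-congˡ = *-cong ≈-refl

  *-congʳ : ∀ {x y u} → x ≈ y → x * u ≈ y * u
  *-congʳ x≈y = *-cong x≈y ≈-refl

  *-zeroʳ : ∀ x → x * 0# ≈ 0#
  *-zeroʳ x = ≈-trans (*-comm x 0#) (*-zeroˡ x)

  *-identityʳ : ∀ x → x * 1# ≈ x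
  *-identityʳ x = ≈-trans (*-comm x 1#) (*-identityˡ x)

  cancel-inverse : ∀ {y z} x → y * z ≈ 1# → y * (z * x) ≈ x
  cancel-inverse {y} {z} x yz≈1 = begin-equality
    y * (z * x)  ≈⟨ *-assoc y z x ⟨
    y * z * x    ≈⟨ *-congʳ yz≈1 ⟩
    1# * x       ≈⟨ *-identityˡ x ⟩
    x            ∎

  *-cancelˡ-≤ : ∀ {x y z} → ¬ (z ≤ 0#) → z * x ≤ z * y → x ≤ y
  *-cancelˡ-≤ {x} {y} {z} z≰0 zx≤zy with w , wz≈1 ← inverse z≰0 = begin
    x            ≈⟨ cancel-inverse x wz≈1 ⟨
    w * (z * x)  ≤⟨ *-mono-≤ ≤-refl zx≤zy ⟩
    w * (z * y)  ≈⟨ cancel-inverse y wz≈1 ⟩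
    y            ∎

  *-≰0 : ∀ {x y} → ¬ (x ≤ 0#) → ¬ (y ≤ 0#) → ¬ (x * y ≤ 0#)
  *-≰0 {x} {y} x≰0 y≰0 xy≤0 =
    y≰0 (*-cancelˡ-≤ x≰0 (≤-trans xy≤0 (0≤ (x * 0#))))

  -- Hyperaddition.

  infix 6 _⊞_

  _⊞_ : Carrier → Carrier → Pred Carrier ℓ
  (x ⊞ y) z = (¬ (x ≈ y) → z ≈ x ⊔ y) × (x ≈ y → z ≤ x)

  ⊞-resp-≈ : ∀ {x x′ y y′ z} → x ≈ x′ → y ≈ y′ → z ∈ x ⊞ y → z ∈ x′ ⊞ y′
  ⊞-resp-≈ {x} {x′} {y} {y′} {z} x≈x′ y≈y′ (max , cap) =
    (λ x′≉y′ → begin-equality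
      z        ≈⟨ max (x′≉y′ ∘ λ x≈y → ≈-trans (≈-sym x≈x′) (≈-trans x≈y y≈y′)) ⟩
      x ⊔ y    ≈⟨ ⊔-mono (proj₁ x≈x′) (proj₁ y≈y′) , ⊔-mono (proj₂ x≈x′) (proj₂ y≈y′) ⟩
      x′ ⊔ y′  ∎) ,
    (λ x′≈y′ → ≤-respʳ-≈ x≈x′ (cap (≈-trans x≈x′ (≈-trans x′≈y′ (≈-sym y≈y′)))))
    where
    ⊔-mono : ∀ {x y u v} → x ≤ y → u ≤ v → x ⊔ u ≤ y ⊔ v
    ⊔-mono x≤y u≤v = ⊔-lub (≤-trans x≤y (x≤x⊔y _ _)) (≤-trans u≤v (y≤x⊔y _ _))

  ⊞-comm : ∀ {x y z} → z ∈ x ⊞ y → z ∈ y ⊞ x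
  ⊞-comm (max , cap) =
    (λ y≉x → ≈-trans (max (y≉x ∘ ≈-sym))
      (⊔-lub (y≤x⊔y _ _) (x≤x⊔y _ _) , ⊔-lub (y≤x⊔y _ _) (x≤x⊔y _ _))) ,
    (λ y≈x → ≤-respʳ-≈ (≈-sym y≈x) (cap (≈-sym y≈x)))

  ⊞-upper : ∀ {x y z w} → z ∈ x ⊞ y → x ≤ w → y ≤ w → z ≤ w
  ⊞-upper {x} {y} (max , cap) x≤w y≤w = by-cases (x ≈ y) λ where
    (yes x≈y) → ≤-trans (cap x≈y) x≤w
    (no  x≉y) → ≤-trans (proj₁ (max x≉y)) (⊔-lub x≤w y≤w)

  ⊞-dominant : ∀ {x y z} → ¬ (y ≤ x) → z ∈ x ⊞ y → z ≈ y
  ⊞-dominant {x} {y} y≰x z∈@(max , _) =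
    ⊞-upper z∈ (≰⇒≥ y≰x) ≤-refl ,
    ≤-trans (y≤x⊔y x y) (proj₂ (max λ x≈y → y≰x (proj₂ x≈y)))

  ⊞-zeroˡ : ∀ {x y z} → x ≈ 0# → z ∈ x ⊞ y → z ≈ y
  ⊞-zeroˡ {x} {y} x≈0 z∈ =
    ⊞-upper z∈ (≤-trans (proj₁ x≈0) (0≤ y)) ≤-refl ,
    -- Only the lower bound needs a case split: either `y` is below `x` and hence 0, or `y`
    -- dominates.
    by-cases (y ≤ x) λ where
      (yes y≤x) → ≤-trans y≤x (≤-trans (proj₁ x≈0) (0≤ _))
      (no  y≰x) → proj₂ (⊞-dominant y≰x z∈)

  -- Both clauses of membership hold without knowing whether `y ≈ x`; this serves at the ends of the
  -- edge, where the outer term is only bounded.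
  ∈⊞-larger : ∀ {x y z} → z ≈ x → y ≤ x → z ∈ x ⊞ y
  ∈⊞-larger {x} {y} z≈x y≤x =
    (λ _ → ≈-trans z≈x (x≤x⊔y x y , ⊔-lub ≤-refl y≤x)) , const (proj₁ z≈x)

  ∈⊞-equal : ∀ {x y z} → x ≈ y → z ≤ x → z ∈ x ⊞ y
  ∈⊞-equal x≈y z≤x = contradiction x≈y , const z≤x

  -- The hypersum relation is symmetric in its three entries: the maximum of `x`, `y`, `z` is
  -- attained twice, so if `y` differs from `z`, then `x` equals `z`. This turns a recursion for `d`
  -- into a coefficient relation.
  ∈⊞-⊔ : ∀ {x y z} → z ≈ x ⊔ y → x ∈ y ⊞ z
  ∈⊞-⊔ {x} {y} {z} z≈x⊔y =
    (λ y≉z → let y≤x = ≰⇒≥ λ x≤y → y≉z (y≤z , ≤-trans (proj₁ z≈x⊔y) (⊔-lub x≤y ≤-refl))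
             in ≤-trans x≤z (y≤x⊔y y z) ,
                ⊔-lub y≤x (≤-trans (proj₁ z≈x⊔y) (⊔-lub ≤-refl y≤x))) ,
    (λ y≈z → ≤-respʳ-≈ (≈-sym y≈z) x≤z)
    where
    x≤z : x ≤ z
    x≤z = ≤-respʳ-≈ (≈-sym z≈x⊔y) (x≤x⊔y x y)
    y≤z : y ≤ z
    y≤z = ≤-respʳ-≈ (≈-sym z≈x⊔y) (y≤x⊔y x y)

  product : (ℕ → Carrier) → (l t : ℕ) → Carrier
  product a l zero    = 1#
  product a l (suc t) = a l * product a (suc l) t

  -- `product` unfolds at its smallest index, whereas each new linear factor appends a root at the
  -- largest one.
  product-snoc : ∀ a l t {m} → l + t ≡ m → product a l (suc t) ≈ product a l t * a m
  product-snoc a l zero    eq with refl ← trans (sym (ℕₚ.+-identityʳ l)) eq = *-comm (a l) 1#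
  product-snoc a l (suc t) {m} eq = begin-equality
    a l * product a (suc l) (suc t)    ≈⟨ *-congˡ (product-snoc a (suc l) t (trans (sym (ℕₚ.+-suc l t)) eq)) ⟩
    a l * (product a (suc l) t * a m)  ≈⟨ *-assoc _ _ _ ⟨
    a l * product a (suc l) t * a m    ∎

  product-≰0 : ∀ a l t → (∀ i → l ℕ.≤ i → i ℕ.< l + t → ¬ (a i ≤ 0#)) → ¬ (product a l t ≤ 0#)
  product-≰0 a l zero    a≰0 = 1≰0
  product-≰0 a l (suc t) a≰0 = *-≰0 (a≰0 l ℕₚ.≤-refl (ℕₚ.m<m+n l (s≤s z≤n)))
    (product-≰0 a (suc l) t λ i l<i i<l+t →
      a≰0 i (ℕₚ.<⇒≤ l<i) (subst (i ℕ.<_) (sym (ℕₚ.+-suc l t)) i<l+t))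

  -- Coefficient bounds for products of linear factors.

  MonotoneOn : ℕ → (ℕ → Carrier) → Set ℓ
  MonotoneOn n a = ∀ {i j} → 1 ℕ.≤ i → i ℕ.≤ j → j ℕ.≤ n → a i ≤ a j

  -- The coefficient bounds of the fundamental theorem for the roots a 1 ≤ … ≤ a n.
  record HasRoots (a : ℕ → Carrier) (n : ℕ) (r : ℕ → Carrier) : Set ℓ where
    field
      above    : ∀ {i} → n ℕ.< i → r i ≈ 0#
      leading  : r n ≈ 1#
      constant : r 0 ≈ product a 1 n
      bound    : ∀ i t → i + t ≡ n → r i ≤ product a (suc i) t
      vertex   : ∀ i t → suc i + suc t ≡ n → ¬ (a (suc (suc i)) ≤ a (suc i)) →
                 r (suc i) ≈ product a (suc (suc i)) (suc t)

  hasRoots-one : ∀ {a r : ℕ → Carrier} → r 0 ≈ a 1 → r 1 ≈ 1# → (∀ {i} → 1 ℕ.< i → r i ≈ 0#) →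
                 HasRoots a 1 r
  hasRoots-one {a} {r} r₀≈a₁ r₁≈1 rᵢ≈0 = record
    { above    = rᵢ≈0
    ; leading  = r₁≈1
    ; constant = r₀
    ; bound    = λ { 0 _ refl → proj₁ r₀ ; 1 0 refl → proj₁ r₁≈1 ; 1 (suc _) () ; (suc (suc _)) _ () }
    ; vertex   = λ { zero _ () ; (suc _) _ () }
    }
    where
    r₀ : r 0 ≈ product a 1 1
    r₀ = ≈-trans r₀≈a₁ (≈-sym (*-identityʳ (a 1)))

  -- Here `s` is `r` times the linear factor with root `a (suc n)`. Since this root is the largest,
  -- replacing another root by it only increases a product, and the summand `r (suc i) * a (suc n)`
  -- dominates at the vertices.
  module _ {a r s : ℕ → Carrier} {n} (a-mono : MonotoneOn (suc n) a) (hr : HasRoots a n r)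
           (s-zero : s 0 ≈ r 0 * a (suc n))
           (s-suc  : ∀ i → s (suc i) ∈ r i ⊞ (r (suc i) * a (suc n))) where
    private
      module R = HasRoots hr

      a′ : Carrier
      a′ = a (suc n)

      rᵢ*a′≈0 : ∀ {i} → n ℕ.< i → r i * a′ ≈ 0#
      rᵢ*a′≈0 n<i = ≈-trans (*-congʳ (R.above n<i)) (*-zeroˡ a′)

      leading : s (suc n) ≈ 1#
      leading = ≈-trans (⊞-zeroˡ (rᵢ*a′≈0 ℕₚ.≤-refl) (⊞-comm (s-suc n))) R.leading

      constant : s 0 ≈ product a 1 (suc n)
      constant = begin-equality
        s 0                 ≈⟨ s-zero ⟩
        r 0 * a′            ≈⟨ *-congʳ R.constant ⟩
        product a 1 n * a′  ≈⟨ product-snoc a 1 n refl ⟨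
        product a 1 (suc n) ∎

      r≤ : ∀ i t → i + suc t ≡ n → r i ≤ a (suc i) * product a (suc (suc i)) t
      r≤ i t = R.bound i (suc t)

      bound : ∀ i t → i + t ≡ suc n → s i ≤ product a (suc i) t
      bound zero    t       refl = proj₁ constant
      bound (suc i) zero    eq with refl ← trans (sym (ℕₚ.+-identityʳ i)) (ℕₚ.suc-injective eq) =
        proj₁ leading
      bound (suc i) (suc t) eq = ⊞-upper (s-suc i)
        (begin
          r i                            ≤⟨ r≤ i t i+[1+t]≡n ⟩
          -- Trading `a (suc i)` for the largest root turns the old bound at `i` into the new one at
          -- `suc i`.
          a (suc i) * Q                  ≤⟨ *-mono-≤ (a-mono (s≤s z≤n) 1+i≤1+n ℕₚ.≤-refl) ≤-refl ⟩
          a′ * Q                         ≈⟨ *-comm a′ Q ⟩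
          Q * a′                         ≈⟨ product-snoc a (suc (suc i)) t 2+i+t≡1+n ⟨
          product a (suc (suc i)) (suc t) ∎)
        (begin
          r (suc i) * a′                 ≤⟨ *-mono-≤ (R.bound (suc i) t (ℕₚ.suc-injective 2+i+t≡1+n)) ≤-refl ⟩
          Q * a′                         ≈⟨ product-snoc a (suc (suc i)) t 2+i+t≡1+n ⟨
          product a (suc (suc i)) (suc t) ∎)
        where
        Q = product a (suc (suc i)) t
        i+[1+t]≡n : i + suc t ≡ n
        i+[1+t]≡n = ℕₚ.suc-injective eq
        2+i+t≡1+n : suc (suc i) + t ≡ suc n
        2+i+t≡1+n = cong suc (trans (sym (ℕₚ.+-suc i t)) i+[1+t]≡n)
        1+i≤1+n : suc i ℕ.≤ suc n
        1+i≤1+n = subst (suc i ℕ.≤_) eq (ℕₚ.m≤m+n (suc i) (suc t))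

      -- Let `Q` be the product of the roots from `suc (suc i)` to `n`. If `r (suc i) * a′` did not
      -- exceed `r i`, then `Q * a′ ≤ r i ≤ a (suc i) * Q`, and cancelling `Q` would put the largest
      -- root below `a (suc i)`, against the jump.
      vertex : ∀ i t → suc i + suc t ≡ suc n → ¬ (a (suc (suc i)) ≤ a (suc i)) →
               s (suc i) ≈ product a (suc (suc i)) (suc t)
      vertex i t eq aᵢ<aᵢ₊₁ = begin-equality
        s (suc i)                       ≈⟨ ⊞-dominant rᵢ<rᵢ₊₁a′ (s-suc i) ⟩
        r (suc i) * a′                  ≈⟨ *-congʳ (rᵢ₊₁≈Q t refl 1+i+t≡n) ⟩
        Q * a′                          ≈⟨ product-snoc a (suc (suc i)) t (cong suc 1+i+t≡n) ⟨
        product a (suc (suc i)) (suc t) ∎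
        where
        Q = product a (suc (suc i)) t
        1+i+t≡n : suc i + t ≡ n
        1+i+t≡n = trans (sym (ℕₚ.+-suc i t)) (ℕₚ.suc-injective eq)
        rᵢ₊₁≈Q : ∀ u → t ≡ u → suc i + t ≡ n → r (suc i) ≈ Q
        -- Here the jump is from root `n` to the new root: `Q` is empty and the leading coefficient
        -- gives the equality.
        rᵢ₊₁≈Q zero    refl eq′ with refl ← trans (sym (ℕₚ.+-identityʳ (suc i))) eq′ = R.leading
        rᵢ₊₁≈Q (suc u) refl eq′ = R.vertex i u eq′ aᵢ<aᵢ₊₁
        Q≰0 : ¬ (Q ≤ 0#)
        -- A zero root past the jump would force `a (suc (suc i))` down to 0, so there would be no
        -- jump.
        Q≰0 = product-≰0 a (suc (suc i)) t λ j 2+i≤j j<2+i+t aⱼ≤0 → aᵢ<aᵢ₊₁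
          (begin
            a (suc (suc i))  ≤⟨ a-mono (s≤s z≤n) 2+i≤j
                                  (ℕₚ.<⇒≤ (subst (j ℕ.<_) (cong suc 1+i+t≡n) j<2+i+t)) ⟩
            a j              ≤⟨ aⱼ≤0 ⟩
            0#               ≤⟨ 0≤ _ ⟩
            a (suc i)        ∎)
        rᵢ<rᵢ₊₁a′ : ¬ (r (suc i) * a′ ≤ r i)
        rᵢ<rᵢ₊₁a′ le = aᵢ<aᵢ₊₁ (begin
          a (suc (suc i))  ≤⟨ a-mono (s≤s z≤n) (s≤s 1+i≤n) ℕₚ.≤-refl ⟩
          a′               ≤⟨ *-cancelˡ-≤ Q≰0 (begin
            Q * a′           ≈⟨ *-congʳ (rᵢ₊₁≈Q t refl 1+i+t≡n) ⟨
            r (suc i) * a′   ≤⟨ le ⟩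
            r i              ≤⟨ r≤ i t (ℕₚ.suc-injective eq) ⟩
            a (suc i) * Q    ≈⟨ *-comm _ _ ⟩
            Q * a (suc i)    ∎) ⟩
          a (suc i)        ∎)
          where
          1+i≤n : suc i ℕ.≤ n
          1+i≤n = subst (suc i ℕ.≤_) 1+i+t≡n (ℕₚ.m≤m+n (suc i) t)

    hasRoots-step : HasRoots a (suc n) s
    hasRoots-step = record
      { above    = λ { {suc i} (s≤s n<i) →
          ⊞-upper (s-suc i) (proj₁ (R.above n<i)) (proj₁ (rᵢ*a′≈0 (ℕₚ.m<n⇒m<1+n n<i))) , 0≤ _ }
      ; leading  = leading
      ; constant = constant
      ; bound    = bound
      ; vertex   = vertex
      }

  -- Newton polygon and division by a linear factor.

  -- C i is the value at i of the Newton polygon of c, written multiplicatively.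
  module NewtonPolygon {a c : ℕ → Carrier} {n : ℕ} {γ : Carrier} (γcₙ≈1 : γ * c n ≈ 1#)
    (hr : HasRoots a n (λ i → γ * c i)) where
    private module R = HasRoots hr

    C : ℕ → Carrier
    C i = product a (suc i) (n ∸ i) * c n

    private
      -- Undoes the normalisation by `γ`, so that bounds for the monic multiple rescale by `c n`.
      c≈ : ∀ i → c i ≈ (γ * c i) * c n
      c≈ i = begin-equality
        c i              ≈⟨ cancel-inverse (c i) γcₙ≈1 ⟨
        γ * (c n * c i)  ≈⟨ *-congˡ (*-comm (c n) (c i)) ⟩
        γ * (c i * c n)  ≈⟨ *-assoc γ (c i) (c n) ⟨
        γ * c i * c n    ∎

    C-step : ∀ {i} → i ℕ.< n → C i ≈ a (suc i) * C (suc i)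
    -- The rewrite turns `n ∸ i` into `suc (n ∸ suc i)`, which exposes the factor `a (suc i)`.
    C-step {i} i<n rewrite ℕₚ.+-∸-assoc 1 i<n = *-assoc _ _ _

    c≤C : ∀ {i} → i ℕ.≤ n → c i ≤ C i
    c≤C {i} i≤n = ≤-trans (proj₁ (c≈ i))
      (*-mono-≤ (R.bound i (n ∸ i) (ℕₚ.m+[n∸m]≡n i≤n)) ≤-refl)

    c₀≈C₀ : c 0 ≈ C 0
    c₀≈C₀ = ≈-trans (c≈ 0) (*-congʳ R.constant)

    cₙ≈Cₙ : c n ≈ C n
    cₙ≈Cₙ rewrite ℕₚ.n∸n≡0 n = ≈-sym (*-identityˡ (c n))

    c≈C-vertex : ∀ {i} → 1 ℕ.≤ i → i ℕ.< n → ¬ (a (suc i) ≤ a i) → c i ≈ C i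
    c≈C-vertex {suc i} _ i<n aᵢ<aᵢ₊₁ rewrite ℕₚ.+-∸-assoc 1 i<n = ≈-trans (c≈ (suc i))
      (*-congʳ (R.vertex i (n ∸ suc (suc i)) (trans (ℕₚ.+-suc (suc i) _) (ℕₚ.m+[n∸m]≡n i<n)) aᵢ<aᵢ₊₁))

  -- Here u = k ∸ 1 and v = k + m ∸ 1 are the ends of the edge of slope α, and C is
  -- the Newton polygon of c.
  module Division {n u v : ℕ} {a c C d : ℕ → Carrier} {α β : Carrier}
    (βα≈1     : β * α ≈ 1#)
    (v≤n      : v ℕ.≤ n)
    (u<v      : u ℕ.< v)
    (a-mono   : MonotoneOn n a)
    (α-root   : ∀ {i} → u ℕ.< i → i ℕ.≤ v → α ≈ a i)
    (C-step   : ∀ {i} → i ℕ.< n → C i ≈ a (suc i) * C (suc i))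
    (c≤C      : ∀ {i} → i ℕ.≤ n → c i ≤ C i)
    (c₀≈C₀    : c 0 ≈ C 0)
    (cₙ≈Cₙ    : c n ≈ C n)
    (cᵤ≈Cᵤ    : 1 ℕ.≤ u → c u ≈ C u)
    (cᵥ≈Cᵥ    : v ℕ.< n → c v ≈ C v)
    (d-upper  : v ℕ.< n → d (n ∸ 1) ≈ c n ×
                  (∀ i → v ℕ.≤ i → 2 + i ℕ.≤ n → d i ≈ c (suc i) ⊔ α * d (suc i)))
    (d-lower  : 1 ℕ.≤ u → d 0 ≈ β * c 0 ×
                  (∀ i → suc i ℕ.< u → d (suc i) ≈ β * c (suc i) ⊔ β * d i))
    (d-middle : ∀ {i} → u ℕ.≤ i → i ℕ.< v → d i ≈ C (suc i))
    where

    private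
      αβx≈x : ∀ x → α * (β * x) ≈ x
      αβx≈x x = cancel-inverse x (≈-trans (*-comm α β) βα≈1)

      -- Multiplication by `β` preserves maxima because it is monotone with monotone inverse `α`.
      -- This clears `β` from the lower recursion.
      α*⊔ : ∀ {x y z} → z ≈ β * x ⊔ β * y → α * z ≈ x ⊔ y
      α*⊔ {x} {y} {z} z≈ =
        (begin
          α * z              ≤⟨ *-mono-≤ ≤-refl (proj₁ z≈) ⟩
          α * (β * x ⊔ β * y)  ≤⟨ *-mono-≤ ≤-refl
            (⊔-lub (*-mono-≤ ≤-refl (x≤x⊔y x y)) (*-mono-≤ ≤-refl (y≤x⊔y x y))) ⟩
          α * (β * (x ⊔ y))  ≈⟨ αβx≈x _ ⟩
          x ⊔ y              ∎) ,
        ⊔-lub (below (x≤x⊔y _ _)) (below (y≤x⊔y _ _))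
        where
        below : ∀ {w} → β * w ≤ β * x ⊔ β * y → w ≤ α * z
        below {w} le = begin
          w            ≈⟨ αβx≈x w ⟨
          α * (β * w)  ≤⟨ *-mono-≤ ≤-refl (≤-respʳ-≈ (≈-sym z≈) le) ⟩
          α * z        ∎

      α-cancel : ∀ {x y} → α * x ≤ α * y → x ≤ y
      α-cancel {x} {y} le = begin
        x            ≈⟨ cancel-inverse x βα≈1 ⟨
        β * (α * x)  ≤⟨ *-mono-≤ ≤-refl le ⟩
        β * (α * y)  ≈⟨ cancel-inverse y βα≈1 ⟩
        y            ∎

      v≥1 : 1 ℕ.≤ v
      v≥1 = ℕₚ.≤-trans (s≤s z≤n) u<v

      α≤a : ∀ {i} → v ℕ.≤ i → i ℕ.≤ n → α ≤ a i
      α≤a v≤i i≤n = ≤-trans (proj₁ (α-root u<v ℕₚ.≤-refl)) (a-mono v≥1 v≤i i≤n)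

      a≤α : ∀ {i} → i ℕ.< v → a (suc i) ≤ α
      a≤α i<v = ≤-respʳ-≈ (≈-sym (α-root u<v ℕₚ.≤-refl)) (a-mono (s≤s z≤n) i<v v≤n)

      -- Convexity of the Newton polygon: from `v` on, every slope is at least `α`. The counterpart
      -- below `v` is `C≤αC`.
      αC≤C : ∀ {i} → v ℕ.≤ i → i ℕ.< n → α * C (suc i) ≤ C i
      αC≤C {i} v≤i i<n = begin
        α * C (suc i)          ≤⟨ *-mono-≤ (α≤a (ℕₚ.m≤n⇒m≤1+n v≤i) i<n) ≤-refl ⟩
        a (suc i) * C (suc i)  ≈⟨ C-step i<n ⟨
        C i                    ∎

      C≤αC : ∀ {i} → i ℕ.< v → C i ≤ α * C (suc i)
      C≤αC {i} i<v = begin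
        C i                    ≈⟨ C-step (ℕₚ.<-≤-trans i<v v≤n) ⟩
        a (suc i) * C (suc i)  ≤⟨ *-mono-≤ (a≤α i<v) ≤-refl ⟩
        α * C (suc i)          ∎

      αd≈C : ∀ {i} → u ℕ.≤ i → i ℕ.< v → α * d i ≈ C i
      αd≈C {i} u≤i i<v = begin-equality
        α * d i                ≈⟨ *-cong (α-root (s≤s u≤i) i<v) (d-middle u≤i i<v) ⟩
        a (suc i) * C (suc i)  ≈⟨ C-step (ℕₚ.<-≤-trans i<v v≤n) ⟨
        C i                    ∎

      -- The recursion runs down from `n ∸ 1`, and `t` counts the steps from there to `i`. Each step
      -- stays below the polygon by `αC≤C`.
      d≤C-upper : ∀ {i} t → i + suc t ≡ n → v ℕ.≤ i → v ℕ.< n → d i ≤ C (suc i)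
      d≤C-upper {i} zero eq v≤i v<n with refl ← trans (sym (ℕₚ.+-comm i 1)) eq =
        ≤-respʳ-≈ cₙ≈Cₙ (proj₁ (proj₁ (d-upper v<n)))
      d≤C-upper {i} (suc t) eq v≤i v<n = begin
        d i                          ≈⟨ proj₂ (d-upper v<n) i v≤i 2+i≤n ⟩
        c (suc i) ⊔ α * d (suc i)    ≤⟨ ⊔-lub (c≤C (ℕₚ.<⇒≤ 2+i≤n)) (begin
          α * d (suc i)                ≤⟨ *-mono-≤ ≤-refl (d≤C-upper t eq′ v≤1+i v<n) ⟩
          α * C (suc (suc i))          ≤⟨ αC≤C v≤1+i 2+i≤n ⟩
          C (suc i)                    ∎) ⟩
        C (suc i)                    ∎
        where
        eq′ : suc i + suc t ≡ n
        eq′ = trans (sym (ℕₚ.+-suc i (suc t))) eq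
        2+i≤n : suc (suc i) ℕ.≤ n
        2+i≤n = subst (suc (suc i) ℕ.≤_) (trans (cong suc (sym (ℕₚ.+-suc i t))) eq′) (s≤s (s≤s (ℕₚ.m≤m+n i t)))
        v≤1+i : v ℕ.≤ suc i
        v≤1+i = ℕₚ.m≤n⇒m≤1+n v≤i

      -- The increasing recursion naturally bounds `α * d i` by `C i`; as `C i ≤ α * C (suc i)`, the
      -- factor `α` then cancels.
      d≤C-lower : ∀ {i} → i ℕ.< u → d i ≤ C (suc i)
      d≤C-lower {i} i<u = α-cancel (≤-trans (αd≤C i i<u) (C≤αC (ℕₚ.<-trans i<u u<v)))
        where
        αd≤C : ∀ i → i ℕ.< u → α * d i ≤ C i
        αd≤C zero i<u = begin
          α * d 0        ≈⟨ *-congˡ (proj₁ (d-lower i<u)) ⟩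
          α * (β * c 0)  ≈⟨ αβx≈x (c 0) ⟩
          c 0            ≈⟨ c₀≈C₀ ⟩
          C 0            ∎
        αd≤C (suc i) i<u = begin
          α * d (suc i)    ≈⟨ α*⊔ (proj₂ (d-lower (ℕₚ.≤-trans (s≤s z≤n) i<u)) i i<u) ⟩
          c (suc i) ⊔ d i  ≤⟨ ⊔-lub (c≤C (ℕₚ.<⇒≤ (ℕₚ.<-≤-trans i<u (ℕₚ.≤-trans (ℕₚ.<⇒≤ u<v) v≤n))))
                                (d≤C-lower (ℕₚ.<⇒≤ i<u)) ⟩
          C (suc i)        ∎

    leading-coeff : c n ≈ d (n ∸ 1)
    leading-coeff with ℕₚ.m≤n⇒m<n∨m≡n v≤n
    ... | inj₁ v<n  = ≈-sym (proj₁ (d-upper v<n))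
    -- The edge reaches `n`, so `d (n ∸ 1)` is a middle coefficient.
    ... | inj₂ refl = begin-equality
      c n                  ≈⟨ cₙ≈Cₙ ⟩
      C n                  ≡⟨ cong C 1+[n-1]≡n ⟨
      C (suc (n ∸ 1))      ≈⟨ d-middle (ℕₚ.≤-pred (subst (u ℕ.<_) (sym 1+[n-1]≡n) u<v))
                                (ℕₚ.≤-reflexive 1+[n-1]≡n) ⟨
      d (n ∸ 1)            ∎
      where
      1+[n-1]≡n : suc (n ∸ 1) ≡ n
      1+[n-1]≡n = ℕₚ.m+[n∸m]≡n v≥1

    constant-coeff : c 0 ≈ α * d 0
    constant-coeff with u ℕₚ.≟ 0
    ... | yes refl = ≈-trans c₀≈C₀ (≈-sym (αd≈C ℕₚ.≤-refl u<v))
    ... | no  u≢0  = ≈-sym (≈-trans (*-congˡ (proj₁ (d-lower (ℕₚ.n≢0⇒n>0 u≢0)))) (αβx≈x (c 0)))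

    inner-coeff : ∀ i → suc i ℕ.< n → c (suc i) ∈ (α * d (suc i)) ⊞ d i
    inner-coeff i 1+i<n with ℕₚ.<-cmp (suc i) u | ℕₚ.<-cmp (suc i) v
    ... | tri< 1+i<u _ _ | _ = ⊞-comm (∈⊞-⊔
          (α*⊔ (proj₂ (d-lower (ℕₚ.≤-trans (s≤s z≤n) 1+i<u)) i 1+i<u)))
    -- At `u`, `d (suc i)` is the first middle coefficient and `d i` the last lower one.
    ... | tri≈ _ refl _ | _ = ∈⊞-larger
          (≈-trans (cᵤ≈Cᵤ (s≤s z≤n)) (≈-sym (αd≈C ℕₚ.≤-refl u<v)))
          (≤-respʳ-≈ (≈-sym (αd≈C ℕₚ.≤-refl u<v)) (d≤C-lower ℕₚ.≤-refl))
    ... | tri> _ _ u<1+i | tri< 1+i<v _ _ = ∈⊞-equal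
          (≈-trans (αd≈C (ℕₚ.<⇒≤ u<1+i) 1+i<v) (≈-sym (d-middle (ℕₚ.≤-pred u<1+i) (ℕₚ.<⇒≤ 1+i<v))))
          (≤-respʳ-≈ (≈-sym (αd≈C (ℕₚ.<⇒≤ u<1+i) 1+i<v)) (c≤C (ℕₚ.<⇒≤ 1+i<n)))
    -- At `v` the roles swap: `d i` is the last middle coefficient and `d (suc i)` the first upper
    -- one.
    ... | tri> _ _ u<1+i | tri≈ _ refl _ = ⊞-comm (∈⊞-larger
          (≈-trans (cᵥ≈Cᵥ 1+i<n) (≈-sym dᵢ≈C))
          (begin
            α * d (suc i)        ≤⟨ *-mono-≤ ≤-refl (d≤C-upper (n ∸ suc (suc i))
                                      (trans (ℕₚ.+-suc (suc i) _) (ℕₚ.m+[n∸m]≡n 1+i<n)) ℕₚ.≤-refl 1+i<n) ⟩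
            α * C (suc (suc i))  ≤⟨ αC≤C ℕₚ.≤-refl 1+i<n ⟩
            C (suc i)            ≈⟨ dᵢ≈C ⟨
            d i                  ∎))
          where
          dᵢ≈C : d i ≈ C (suc i)
          dᵢ≈C = d-middle (ℕₚ.≤-pred u<1+i) ℕₚ.≤-refl
    ... | tri> _ _ _ | tri> _ _ v<1+i = ∈⊞-⊔
          (proj₂ (d-upper (ℕₚ.<-trans v<1+i 1+i<n)) i (ℕₚ.≤-pred v<1+i) 1+i<n)

open import Defs

-- Archimedean property of the rationals.

fromℕ : ℕ → ℚ
fromℕ n = mkℚ (ℤ.+ n) 0 (Coprimality.sym (1-coprimeTo n))

-- Addition in `ℚ` normalises its result, so the equation is checked on unnormalised fractions.
fromℕ-suc : ∀ n → fromℕ (suc n) ≡ 1ℚ ℚ.+ fromℕ n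
fromℕ-suc n = ℚₚ.toℚᵘ-injective (ℚᵘₚ.≃-trans
  (ℚᵘ.*≡* (cong (λ i → (ℤ.+ 1 ℤ.+ i) ℤ.* ℤ.+ 1) (sym (ℤₚ.*-identityʳ (ℤ.+ n)))))
  (ℚᵘₚ.≃-sym (ℚₚ.toℚᵘ-homo-+ 1ℚ (fromℕ n))))

-- A nonnegative fraction is at most its numerator, the denominator being at least 1.
≤-fromℕ : ∀ p → ∃ λ n → p ℚ.≤ fromℕ n
≤-fromℕ (mkℚ (ℤ.+ n) _ _) = n , *≤* (ℤₚ.*-monoˡ-≤-nonNeg (ℤ.+ n) (ℤ.+≤+ (s≤s z≤n)))
≤-fromℕ p@(mkℚ (ℤ.-[1+ _ ]) _ _) = 0 , ℚₚ.nonPositive⁻¹ p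

divide : ∀ q {r} → 0ℚ ℚ.< r → ∃ λ a → a ℚ.* r ≡ q × (0ℚ ℚ.< q → 0ℚ ℚ.< a)
divide q {r} 0<r = q ℚ.* 1/ r ,
  trans (ℚₚ.*-assoc q (1/ r) r) (trans (cong (q ℚ.*_) (ℚₚ.*-inverseˡ r)) (ℚₚ.*-identityʳ q)) ,
  λ 0<q → 0<* 0<q (ℚₚ.positive⁻¹ (1/ r) {{ℚₚ.1/pos⇒pos r}})
  where
  instance
    r⁺ : ℚ.Positive r
    r⁺ = positive 0<r
    r≢0 : ℚ.NonZero r
    r≢0 = ℚₚ.pos⇒nonZero r

archimedes : ∀ {δ} → 0ℚ ℚ.< δ → ∀ p → ∃ λ n → p ℚ.≤ fromℕ n ℚ.* δ
archimedes {δ} 0<δ p =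
  let a , aδ≡p , _ = divide p 0<δ
      n , a≤n = ≤-fromℕ a
  in n , subst (ℚ._≤ fromℕ n ℚ.* δ) aδ≡p
           (ℚₚ.*-monoʳ-≤-nonNeg δ {{nonNegative (ℚₚ.<⇒≤ 0<δ)}} a≤n)

-- Order, multiplication and inverses of cuts.

⊆⇒≤ : ∀ x y → (∀ {q} → L x q → L y q) → x ≤ y
⊆⇒≤ _ _ x⊆y (_ , lx , ¬ly) = ¬ly (x⊆y lx)

≤-elim : ∀ x y → x ≤ y → ∀ {q} → L x q → ¬ ¬ L y q
≤-elim _ _ x≤y lx ¬ly = x≤y (_ , lx , ¬ly)

≤-trans : ∀ x y z → x ≤ y → y ≤ z → x ≤ z
≤-trans x y z x≤y y≤z (q , lx , ¬lz) = ≤-elim x y x≤y lx λ ly → ≤-elim y z y≤z ly ¬lz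

-- Cuts are nested: a rational in `y` but not in `x` lies above every element of `x`, which puts `x`
-- inside `y`.
≰⇒≥ : ∀ x y → ¬ (x ≤ y) → y ≤ x
≰⇒≥ x y x≰y (q , ly , ¬lx) = x≰y λ (r , lx , ¬ly) →
  ¬ly (ℝ≥0.lower y (ℝ≥0.pos x lx) (ℚₚ.<⇒≤ (below x lx (ℝ≥0.pos y ly) ¬lx)) ly)

*-comm-≤ : ∀ x y → x * y ≤ y * x
*-comm-≤ x y = ⊆⇒≤ (x * y) (y * x) λ (0<q , a , b , la , lb , q≤ab) →
  0<q , b , a , lb , la , subst (_ ℚ.≤_) (ℚₚ.*-comm a b) q≤ab

*-assoc-≤ : ∀ x y z → (x * y) * z ≤ x * (y * z)
*-assoc-≤ x y z = ⊆⇒≤ ((x * y) * z) (x * (y * z))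
  λ (0<q , ab , c , (0<ab , a , b , la , lb , ab≤a*b) , lc , q≤ab*c) →
  0<q , a , b ℚ.* c , la ,
  (0<* (ℝ≥0.pos y lb) (ℝ≥0.pos z lc) , b , c , lb , lc , ℚₚ.≤-refl) ,
  subst (_ ℚ.≤_) (ℚₚ.*-assoc a b c)
    (ℚₚ.≤-trans q≤ab*c (*-mono-≤ (0<* (ℝ≥0.pos x la) (ℝ≥0.pos y lb)) (ℝ≥0.pos z lc) ab≤a*b ℚₚ.≤-refl))

*-monoʳ : ∀ x y z → x ≤ y → x * z ≤ y * z
*-monoʳ x y z x≤y (q , (0<q , a , b , la , lb , q≤ab) , ¬l) =
  ≤-elim x y x≤y la λ la′ → ¬l (0<q , a , b , la′ , lb , q≤ab)

*-monoˡ : ∀ x y z → x ≤ y → z * x ≤ z * y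
*-monoˡ x y z x≤y (q , (0<q , a , b , la , lb , q≤ab) , ¬l) =
  ≤-elim x y x≤y lb λ lb′ → ¬l (0<q , a , b , la , lb′ , q≤ab)

*-identityˡ-≤ : ∀ x → 1ᵣ * x ≤ x
*-identityˡ-≤ x = ⊆⇒≤ (1ᵣ * x) x λ (0<q , a , b , (0<a , a<1) , lb , q≤ab) →
  ℝ≥0.lower x 0<q (ℚₚ.≤-trans q≤ab (subst (a ℚ.* b ℚ.≤_) (ℚₚ.*-identityˡ b)
    (*-mono-≤ 0<1 (ℝ≥0.pos x lb) (ℚₚ.<⇒≤ a<1) ℚₚ.≤-refl))) lb

-- Openness of the cut gives some `r > q` in `x`, and then `q = (q / r) r` with `q / r < 1`.
*-identityˡ-≥ : ∀ x → x ≤ 1ᵣ * x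
*-identityˡ-≥ x = ⊆⇒≤ x (1ᵣ * x) λ {q} lq →
  let r , q<r , lr = ℝ≥0.open′ x lq
      a , ar≡q , 0<a = divide q (ℝ≥0.pos x lr)
      a<1 = ℚₚ.*-cancelʳ-<-nonNeg r {{nonNegative (ℚₚ.<⇒≤ (ℝ≥0.pos x lr))}}
              (subst₂ ℚ._<_ (sym ar≡q) (sym (ℚₚ.*-identityˡ r)) q<r)
  in ℝ≥0.pos x lq , a , r , (0<a (ℝ≥0.pos x lq) , a<1) , lr , ℚₚ.≤-reflexive (sym ar≡q)

-- Walking up from a point of the cut in steps of δ must leave it, by Archimedes.
crossing : ∀ x {b δ} → L x b → 0ℚ ℚ.< δ →
           ¬ ¬ (∃ λ b′ → b ℚ.≤ b′ × L x b′ × ¬ L x (b′ ℚ.+ δ))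
crossing x {b} {δ} lb 0<δ k = ℝ≥0.bounded x λ (s , 0<s , ¬ls) →
  let n , s≤nδ = archimedes 0<δ s
  in walk n b ℚₚ.≤-refl lb λ l →
       ¬ls (ℝ≥0.lower x 0<s (ℚₚ.≤-trans s≤nδ (b+-≥ (fromℕ n ℚ.* δ))) l)
  where
  b+-≥ : ∀ p → p ℚ.≤ b ℚ.+ p
  b+-≥ p = subst (ℚ._≤ b ℚ.+ p) (ℚₚ.+-identityˡ p) (ℚₚ.+-monoˡ-≤ p (ℚₚ.<⇒≤ (ℝ≥0.pos x lb)))
  walk : ∀ n c → b ℚ.≤ c → L x c → ¬ ¬ L x (c ℚ.+ fromℕ n ℚ.* δ)
  walk zero    c b≤c lc ¬l =
    ¬l (subst (L x) (sym (trans (cong (c ℚ.+_) (ℚₚ.*-zeroˡ δ)) (ℚₚ.+-identityʳ c))) lc)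
  walk (suc n) c b≤c lc ¬l = k (c , b≤c , lc , λ lc+δ →
    walk n (c ℚ.+ δ) (ℚₚ.≤-trans b≤c c≤c+δ) lc+δ (¬l ∘ subst (L x) assoc))
    where
    c≤c+δ : c ℚ.≤ c ℚ.+ δ
    c≤c+δ = subst (ℚ._≤ c ℚ.+ δ) (ℚₚ.+-identityʳ c) (ℚₚ.+-monoʳ-≤ c (ℚₚ.<⇒≤ 0<δ))
    assoc : c ℚ.+ δ ℚ.+ fromℕ n ℚ.* δ ≡ c ℚ.+ fromℕ (suc n) ℚ.* δ
    assoc = trans (ℚₚ.+-assoc c δ _) (cong (c ℚ.+_)
      (sym (trans (cong (ℚ._* δ) (fromℕ-suc n))
        (trans (ℚₚ.*-distribʳ-+ δ 1ℚ (fromℕ n)) (cong (ℚ._+ fromℕ n ℚ.* δ) (ℚₚ.*-identityˡ δ))))))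

inv-*-≤ : ∀ x (x≉0 : x ≉ 0ᵣ) → inv x x≉0 * x ≤ 1ᵣ
inv-*-≤ x x≉0 = ⊆⇒≤ (inv x x≉0 * x) 1ᵣ
  λ (0<q , a , b , (0<a , s , 0<s , ¬ls , as<1) , lb , q≤ab) →
  0<q , ℚₚ.≤-<-trans q≤ab (ℚₚ.<-trans
    (ℚₚ.*-monoʳ-<-pos a {{positive 0<a}} (below x lb 0<s ¬ls)) as<1)

-- With 1 < r < 1/q and δ = b (r ∸ 1), every b′ ≥ b satisfies q (b′ + δ) ≤ q r b′ < b′.
inv-*-≥ : ∀ x (x≉0 : x ≉ 0ᵣ) → 1ᵣ ≤ inv x x≉0 * x
inv-*-≥ x x≉0 (q , (0<q , q<1) , ¬l) = x≉0 ((λ (b , lb , _) → nonzero b lb) , λ ())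
  where
  nonzero : ∀ b → ¬ L x b
  nonzero b lb =
    let r , 1<r , rq<1 = room 0<q (subst (ℚ._< 1ℚ) (sym (ℚₚ.*-identityˡ q)) q<1)
        ε = r ℚ.- 1ℚ
        0<ε = subst (ℚ._< ε) (ℚₚ.+-inverseʳ 1ℚ) (ℚₚ.+-monoˡ-< (ℚ.- 1ℚ) 1<r)
        r≡1+ε = trans (sym (ℚₚ.+-identityʳ r)) (trans (cong (r ℚ.+_) (sym (ℚₚ.+-inverseˡ 1ℚ)))
                  (trans (sym (ℚₚ.+-assoc r (ℚ.- 1ℚ) 1ℚ)) (ℚₚ.+-comm ε 1ℚ)))
        0<b = ℝ≥0.pos x lb
    in crossing x lb (0<* 0<b 0<ε) λ (b′ , b≤b′ , lb′ , ¬lb′+δ) →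
    let 0<b′ = ℝ≥0.pos x lb′
        s = b′ ℚ.+ b ℚ.* ε
        s≤b′r = subst (s ℚ.≤_)
          (trans (cong (ℚ._+ b′ ℚ.* ε) (sym (ℚₚ.*-identityʳ b′)))
            (trans (sym (ℚₚ.*-distribˡ-+ b′ 1ℚ ε)) (cong (b′ ℚ.*_) (sym r≡1+ε))))
          (ℚₚ.+-monoʳ-≤ b′ (*-mono-≤ 0<b′ 0<ε b≤b′ ℚₚ.≤-refl))
        a , ab′≡q , q⇒a = divide q 0<b′
        0<a = q⇒a 0<q
        as<1 = ℚₚ.≤-<-trans (ℚₚ.*-monoˡ-≤-nonNeg a {{nonNegative (ℚₚ.<⇒≤ 0<a)}} s≤b′r)
          (subst (ℚ._< 1ℚ)
            (trans (ℚₚ.*-comm r q) (trans (cong (ℚ._* r) (sym ab′≡q)) (ℚₚ.*-assoc a b′ r))) rq<1)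
        0<s = ℚₚ.<-≤-trans 0<b′ (subst (ℚ._≤ s) (ℚₚ.+-identityʳ b′)
                (ℚₚ.+-monoʳ-≤ b′ (ℚₚ.<⇒≤ (0<* 0<b 0<ε))))
    in ¬l (0<q , a , b′ , (0<a , s , 0<s , ¬lb′+δ , as<1) , lb′ , ℚₚ.≤-reflexive (sym ab′≡q))

ℝ≥0-tropicalSemifield : TropicalSemifield _ _
ℝ≥0-tropicalSemifield = record
  { Carrier = ℝ≥0 ; _≤_ = _≤_ ; _⊔_ = _⊔_ ; _*_ = _*_ ; 0# = 0ᵣ ; 1# = 1ᵣ
  ; ≤-refl      = λ {x} → ⊆⇒≤ x x λ l → l
  ; ≤-trans     = λ {x} {y} {z} → ≤-trans x y z
  ; ≤-stable    = negated-stable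
  ; ≰⇒≥         = λ {x} {y} → ≰⇒≥ x y
  ; x≤x⊔y       = λ x y → ⊆⇒≤ x (x ⊔ y) inj₁
  ; y≤x⊔y       = λ x y → ⊆⇒≤ y (x ⊔ y) inj₂
  ; ⊔-lub       = λ { x≤z y≤z (q , inj₁ lx , ¬lz) → x≤z (q , lx , ¬lz)
                    ; x≤z y≤z (q , inj₂ ly , ¬lz) → y≤z (q , ly , ¬lz) }
  ; 0≤          = λ _ ()
  ; 1≰0         = λ 1≤0 → let q , 0<q , q<1 = ℚₚ.<-dense 0<1 in 1≤0 (q , (0<q , q<1) , λ ())
  ; *-mono-≤    = λ {x} {y} {u} {v} x≤y u≤v →
      ≤-trans (x * u) (y * u) (y * v) (*-monoʳ x y u x≤y) (*-monoˡ u v y u≤v)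
  ; *-comm      = λ x y → *-comm-≤ x y , *-comm-≤ y x
  ; *-assoc     = λ x y z → *-assoc-≤ x y z ,
      ⊆⇒≤ (x * (y * z)) ((x * y) * z) λ (0<q , a , bc , la , (0<bc , b , c , lb , lc , bc≤b*c) , q≤a*bc) →
        0<q , a ℚ.* b , c ,
        (0<* (ℝ≥0.pos x la) (ℝ≥0.pos y lb) , a , b , la , lb , ℚₚ.≤-refl) , lc ,
        subst (_ ℚ.≤_) (sym (ℚₚ.*-assoc a b c))
          (ℚₚ.≤-trans q≤a*bc (*-mono-≤ (ℝ≥0.pos x la) 0<bc ℚₚ.≤-refl bc≤b*c))
  ; *-identityˡ = λ x → *-identityˡ-≤ x , *-identityˡ-≥ x
  ; *-zeroˡ     = λ x → (λ { (_ , (_ , _ , _ , () , _) , _) }) , λ ()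
  ; inverse     = λ {x} x≰0 → let x≉0 = λ x≈0 → x≰0 (proj₁ x≈0)
                              in inv x x≉0 , inv-*-≤ x x≉0 , inv-*-≥ x x≉0
  }

-- Hyperproducts with a linear factor.

private
  module T = Tropical ℝ≥0-tropicalSemifield

product-≡ : ∀ a l t → T.product a l t ≡ product a l t
product-≡ a l zero    = refl
product-≡ a l (suc t) = cong (a l *_) (product-≡ a (suc l) t)

-- Zero is neutral for `⊞`. With the linear factor on the right, this collapses all terms before the
-- last two.
⊞Σ-last : ∀ {f n c} → (∀ i → i ℕ.< n → f i ≈ 0ᵣ) → c ∈ ⊞Σ f n → c ≈ f n
⊞Σ-last f≈0 (single c≈f₀) = c≈f₀
⊞Σ-last {f} {suc n} {c} f≈0 (step {b = b} b∈ c∈) = T.⊞-zeroˡ {b} {f (suc n)} {c}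
  (T.≈-trans {b} {f n} {0ᵣ} (⊞Σ-last (λ i i<n → f≈0 i (ℕₚ.m<n⇒m<1+n i<n)) b∈) (f≈0 n ℕₚ.≤-refl)) c∈

-- With the linear factor on the left the relevant terms come first, and every later zero is
-- absorbed.
⊞Σ-first-two : ∀ {f} c n → (∀ i → f (suc (suc i)) ≈ 0ᵣ) → c ∈ f 0 ⊞ f 1 → c ∈ ⊞Σ f (suc n)
⊞Σ-first-two {f} c zero    f≈0 c∈ = step {b = f 0} (single (≈-refl (f 0))) c∈
⊞Σ-first-two {f} c (suc n) f≈0 c∈ = step (⊞Σ-first-two c n f≈0 c∈)
  (T.∈⊞-larger {c} {f (suc (suc n))} {c} (≈-refl c)
    (T.≤-trans {f (suc (suc n))} {0ᵣ} {c} (proj₁ (f≈0 n)) (T.0≤ c)))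

coeff-T+-high : ∀ a {j} → 2 ℕ.≤ j → coeff (T+ a) j ≈ 0ᵣ
coeff-T+-high a (s≤s (s≤s _)) = ≈-refl 0ᵣ

module _ {r s : Poly} {a : 𝕋} (s∈ : s ∈ r ⊡ (T+ a)) where

  ⊡-T+-zero : coeff s 0 ≈ coeff r 0 * a
  ⊡-T+-zero with single s₀≈ ← s∈ 0 = s₀≈

  ⊡-T+-suc : ∀ i → coeff s (suc i) ∈ coeff r i ⊞ coeff r (suc i) * a
  ⊡-T+-suc i with step {b = b} b∈ sᵢ∈ ← s∈ (suc i) =
    T.⊞-resp-≈ {b} {coeff r i} {f (suc i)} {coeff r (suc i) * a} {coeff s (suc i)}
      (T.≈-trans {b} {f i} {coeff r i} (⊞Σ-last low b∈) fᵢ≈rᵢ)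
      fᵢ₊₁≈rᵢ₊₁a sᵢ∈
    where
    f : ℕ → 𝕋
    f k = coeff r k * coeff (T+ a) (suc i ∸ k)
    low : ∀ j → j ℕ.< i → f j ≈ 0ᵣ
    -- For `j < i` the complementary index is at least 2, beyond the degree of the linear factor.
    low j j<i = *-zeroʳ (coeff r j) (coeff (T+ a) (suc i ∸ j)) (coeff-T+-high a
      (subst (2 ℕ.≤_) (sym (ℕₚ.+-∸-assoc 1 (ℕₚ.<⇒≤ j<i))) (s≤s (ℕₚ.m<n⇒0<n∸m j<i))))
    fᵢ≈rᵢ : f i ≈ coeff r i
    fᵢ≈rᵢ rewrite ℕₚ.m+n∸n≡m 1 i = T.*-identityʳ (coeff r i)
    fᵢ₊₁≈rᵢ₊₁a : f (suc i) ≈ coeff r (suc i) * a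
    fᵢ₊₁≈rᵢ₊₁a rewrite ℕₚ.n∸n≡0 i = ≈-refl (coeff r (suc i) * a)

-- Forward direction of the fundamental theorem, by induction on the number of factors; as the roots
-- increase, each new factor brings the largest root so far.
⊡∏⇒hasRoots : ∀ {a n r} → T.MonotoneOn n a → r ∈ ⊡∏ (λ i → T+ a i) n → T.HasRoots a n (coeff r)
⊡∏⇒hasRoots _ (single r≈) =
  T.hasRoots-one (r≈ 0) (r≈ 1) λ { {suc (suc i)} _ → r≈ (suc (suc i)) ; {suc zero} (s≤s ()) }
⊡∏⇒hasRoots {a} {suc n} {s} a-mono (step {r = r} r∈ s∈) = T.hasRoots-step a-mono
  (⊡∏⇒hasRoots (λ 1≤i i≤j j≤n → a-mono 1≤i i≤j (ℕₚ.m≤n⇒m≤1+n j≤n)) r∈)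
  (⊡-T+-zero {r} {s} {a (suc n)} s∈) (⊡-T+-suc {r} {s} {a (suc n)} s∈)

steps⇒monotone : ∀ {n} a → (∀ i → 1 ℕ.≤ i → i ℕ.< n → a i ≤ a (suc i)) → T.MonotoneOn n a
steps⇒monotone a a-step {i} {zero}  1≤i i≤j _   with () ← ℕₚ.≤-trans 1≤i i≤j
steps⇒monotone a a-step {i} {suc j} 1≤i i≤j j<n with ℕₚ.m≤n⇒m<n∨m≡n i≤j
... | inj₂ refl      = T.≤-refl {a i}
... | inj₁ (s≤s i≤j′) = T.≤-trans {a i} {a j} {a (suc j)}
  (steps⇒monotone a a-step 1≤i i≤j′ (ℕₚ.<⇒≤ j<n)) (a-step j (ℕₚ.≤-trans 1≤i i≤j′) j<n)

polyBelow-< : ∀ {n i} d → i ℕ.< n → coeff (polyBelow n d) i ≈ d i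
polyBelow-< {n} {i} d i<n with i ℕₚ.<? n
... | yes _   = ≈-refl (d i)
... | no  i≮n = contradiction i<n i≮n

polyBelow-≥ : ∀ {n i} d → n ℕ.≤ i → coeff (polyBelow n d) i ≈ 0ᵣ
polyBelow-≥ {n} d = proj₂ (finiteSupport (polyBelow n d)) _

module _ {p : Poly} {α : 𝕋} {d : ℕ → 𝕋} {n : ℕ} (1≤n : 1 ℕ.≤ n)
         (above    : ∀ i → n ℕ.< i → coeff p i ≈ 0ᵣ)
         (leading  : coeff p n ≈ d (n ∸ 1))
         (constant : coeff p 0 ≈ α * d 0)
         (inner    : ∀ i → suc i ℕ.< n → coeff p (suc i) ∈ α * d (suc i) ⊞ d i) where
  private
    q : ℕ → 𝕋
    q = coeff (polyBelow n d)

    αq≈0 : ∀ {i} → n ℕ.≤ i → α * q i ≈ 0ᵣ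
    αq≈0 {i} n≤i = *-zeroʳ α (q i) (polyBelow-≥ d n≤i)

    -- Extends the relations to all indices: at `n` only `q i` survives, and past `n` everything is
    -- 0.
    coeff∈ : ∀ i → coeff p (suc i) ∈ α * q (suc i) ⊞ q i
    coeff∈ i with ℕₚ.<-cmp (suc i) n
    ... | tri< 1+i<n _ _ =
      T.⊞-resp-≈ {α * d (suc i)} {α * q (suc i)} {d i} {q i} {coeff p (suc i)}
        (T.*-congˡ {α} {d (suc i)} {q (suc i)} (swap (polyBelow-< d 1+i<n)))
        (swap (polyBelow-< d (ℕₚ.<⇒≤ 1+i<n))) (inner i 1+i<n)
    ... | tri≈ _ refl _ = T.⊞-comm {q i} {α * q (suc i)} {coeff p (suc i)}
      (T.∈⊞-larger {q i} {α * q (suc i)} {coeff p (suc i)}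
        (T.≈-trans {coeff p (suc i)} {d i} {q i} leading (swap (polyBelow-< d ℕₚ.≤-refl)))
        (T.≤-trans {α * q (suc i)} {0ᵣ} {q i} (proj₁ (αq≈0 {suc i} ℕₚ.≤-refl)) (T.0≤ (q i))))
    ... | tri> _ _ n<1+i = T.∈⊞-equal {α * q (suc i)} {q i} {coeff p (suc i)}
      (T.≈-trans {α * q (suc i)} {0ᵣ} {q i} (αq≈0 (ℕₚ.<⇒≤ n<1+i)) (swap (polyBelow-≥ d (ℕₚ.≤-pred n<1+i))))
      (T.≤-trans {coeff p (suc i)} {0ᵣ} {α * q (suc i)} (proj₁ (above (suc i) n<1+i)) (T.0≤ (α * q (suc i))))

  ∈T+⊡polyBelow : p ∈ (T+ α) ⊡ polyBelow n d
  ∈T+⊡polyBelow zero = single (T.≈-trans {coeff p 0} {α * d 0} {α * q 0} constant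
    (T.*-congˡ {α} {d 0} {q 0} (swap (polyBelow-< d 1≤n))))
  ∈T+⊡polyBelow (suc i) = ⊞Σ-first-two (coeff p (suc i)) i
    (λ j → T.*-zeroˡ (q (suc i ∸ suc (suc j))))
    (T.⊞-resp-≈ {α * q (suc i)} {α * q (suc i)} {q i} {1ᵣ * q i} {coeff p (suc i)}
      (≈-refl (α * q (suc i))) (swap (T.*-identityˡ (q i))) (coeff∈ i))

mainTheorem6 :
    (n : ℕ) → 1 ℕ.≤ n →
    (p : Poly) (deg : HasDegree p n) →
    -- the roots a₁ ≤ … ≤ aₙ (the values a i with i = 0 or i > n are not used)
    (a : ℕ → 𝕋) →
    (∀ i → 1 ℕ.≤ i → i ℕ.< n → a i ≤ a (suc i)) →
    inv (coeff p n) (leading≉0 deg) ·ₚ p ∈ ⊡∏ (λ i → T+ a i) n →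
    -- the nonzero root α = a_k = … = a_{k+m-1}
    (α : 𝕋) (α≉0 : α ≉ 0ᵣ) →
    (k m : ℕ) → 1 ℕ.≤ k → k ℕ.≤ n → 1 ℕ.≤ m → k + m ∸ 1 ℕ.≤ n →
    (∀ i → k ℕ.≤ i → i ℕ.≤ k + m ∸ 1 → α ≈ a i) →
    (2 ℕ.≤ k → a (k ∸ 1) < a k) →
    (k + m ℕ.≤ n → a (k + m ∸ 1) < a (k + m)) →
    -- the coefficients d₀, …, dₙ₋₁ (the values d i with i ≥ n are not used)
    (d : ℕ → 𝕋) →
    (k + m ℕ.≤ n →
      d (n ∸ 1) ≈ coeff p n ×
      (∀ i → k + m ∸ 1 ℕ.≤ i → 2 + i ℕ.≤ n →
        d i ≈ coeff p (suc i) ⊔ α * d (suc i))) →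
    (2 ℕ.≤ k →
      d 0 ≈ inv α α≉0 * coeff p 0 ×
      (∀ i → 1 ℕ.≤ i → 2 + i ℕ.≤ k →
        d i ≈ inv α α≉0 * coeff p i ⊔ inv α α≉0 * d (i ∸ 1))) →
    (∀ i → k ∸ 1 ℕ.≤ i → 2 + i ℕ.≤ k + m →
      d i ≈ ∏[ 2 + i ⋯ n ] a * coeff p n) →
    (p ∈ (T+ α) ⊡ polyBelow n d) ×
    coeff p n ≈ d (n ∸ 1) ×
    coeff p 0 ≈ α * d 0 ×
    (∀ i → 1 ℕ.≤ i → i ℕ.< n → coeff p i ∈ α * d i ⊞ d (i ∸ 1))
-- Matching `k` and `m` as successors makes `k ∸ 1` and `k + m ∸ 1` reduce to `u` and `v`, and
-- `k + m ≤ n` becomes `v < n`.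
mainTheorem6 n 1≤n p deg a a-step p∈ α α≉0 (suc u) (suc m) _ u<n _ v≤n α-root a-left a-right
             d d-upper d-lower d-middle =
  ∈T+⊡polyBelow {p} {α} {d} 1≤n (above≈0 deg) D.leading-coeff D.constant-coeff D.inner-coeff ,
  D.leading-coeff , D.constant-coeff , λ { (suc i) _ → D.inner-coeff i }
  where
  v = u + suc m
  c = coeff p

  a-mono : T.MonotoneOn n a
  a-mono = steps⇒monotone a a-step

  module N = T.NewtonPolygon {a} {c} {n} {inv (c n) (leading≉0 deg)}
    (inv-*-≤ (c n) (leading≉0 deg) , inv-*-≥ (c n) (leading≉0 deg)) (⊡∏⇒hasRoots a-mono p∈)

  dᵢ≈C : ∀ {i} → u ℕ.≤ i → i ℕ.< v → d i ≈ N.C (suc i)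
  -- The length `suc n ∸ (2 + i)` of the given product reduces to `n ∸ suc i`, the length in
  -- `C (suc i)`.
  dᵢ≈C {i} u≤i i<v = subst (λ x → d i ≈ x * c n) (sym (product-≡ a (2 + i) (n ∸ suc i)))
    (d-middle i u≤i (s≤s i<v))

  module D = T.Division {n} {u} {v} {a} {c} {N.C} {d} {α} {inv α α≉0}
    (inv-*-≤ α α≉0 , inv-*-≥ α α≉0) v≤n (ℕₚ.m<m+n u (s≤s z≤n)) a-mono
    (λ {i} → α-root i) N.C-step N.c≤C N.c₀≈C₀ N.cₙ≈Cₙ
    (λ 1≤u → N.c≈C-vertex 1≤u u<n λ le → le (a-left (s≤s 1≤u)))
    (λ v<n → N.c≈C-vertex (ℕₚ.≤-trans (s≤s z≤n) (ℕₚ.m≤n+m (suc m) u)) v<n λ le → le (a-right v<n))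
    d-upper
    (λ 1≤u → proj₁ (d-lower (s≤s 1≤u)) , λ i i<u → proj₂ (d-lower (s≤s 1≤u)) (suc i) (s≤s z≤n) (s≤s i<u))
    dᵢ≈C
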